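{- Let $G$ be a graph of order $n=4k+1$, where $k\ge 0$ is an integer. If the Seidel matrix $S$ of $G$ is singular and $\phi(S)\in\{\pm 1\}^n$, then $$3k\le |E(G)|\le 8k^2-k.$$ Moreover, both bounds are tight: for every natural number $k$ there is a graph of order $n=4k+1$ with singular Seidel matrix $S$ and $\phi(S)\in\{\pm1\}^n$ having exactly $3k$ edges, and there is such a graph having exactly $8k^2-k$ edges.
   Context: All graphs are simple, undirected, finite, with at least one vertex. The order of a graph is its number of vertices; $E(G)$ is the edge set of $G$. For a graph $G$ with vertices $v_1,\dots,v_n$ and adjacency matrix $A$, the Seidel matrix of $G$ is $S=J_n-I_n-2A$, where $J_n$ is the all-ones $n\times n$ matrix and $I_n$ the identity. It is known that $\operatorname{rank} S\ge n-1$ always. Hence, when $S$ is singular, its nullspace is one-dimensional, and $\phi(S)$ denotes the unique integer vector $\phi\in\mathbb{Z}^n$ with $S\phi=0$, with the greatest common divisor of its entries equal to $1$, and with first non-zero entry positive. -}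

module Defs where

open import Data.Bool.Base using (Bool; true; false; if_then_else_)
import Data.Bool.Properties as Bool
open import Data.Fin.Base using (Fin; _<_)
open import Data.Fin.Properties using (_≟_; _<?_)
open import Data.Integer.Base as ℤ using (ℤ; +_; 0ℤ; 1ℤ)
open import Data.Integer.GCD using (gcd)
import Data.Integer.Properties as ℤ
open import Data.List.Base using (List; allFin; cartesianProduct; filter; length)
open import Data.Nat.Base using (ℕ)
open import Data.Product.Base using (_×_; _,_; ∃-syntax)
open import Data.Rational.Base as ℚ using (ℚ)
import Data.Rational.Properties as ℚ
open import Data.Vec.Functional using (Vector; foldr)
open import Relation.Binary.PropositionalEquality.Core using (_≡_)
open import Relation.Nullary.Decidable.Core using (does; _×-dec_)
open import Relation.Nullary.Negation.Core using (¬_)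

open import Algebra.Properties.Monoid.Sum ℤ.+-0-monoid
  using () renaming (sum to sumℤ)
open import Algebra.Properties.Monoid.Sum ℚ.+-0-monoid
  using () renaming (sum to sumℚ)

record Graph (n : ℕ) : Set where
  field
    adj    : Fin n → Fin n → Bool
    symm   : ∀ i j → adj i j ≡ adj j i
    irrefl : ∀ i → adj i i ≡ false

open Graph public

-- The edge {i , j} is listed once, as the pair (i , j) with i < j.
edges : ∀ {n} → Graph n → List (Fin n × Fin n)
edges {n} G =
  filter (λ (i , j) → (i <? j) ×-dec (adj G i j Bool.≟ true))
         (cartesianProduct (allFin n) (allFin n))

∣E_∣ : ∀ {n} → Graph n → ℕ
∣E G ∣ = length (edges G)

Matrix : Set → ℕ → Set
Matrix A n = Fin n → Fin n → A

J : ∀ n → Matrix ℤ n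
J n i j = 1ℤ

I : ∀ n → Matrix ℤ n
I n i j = if does (i ≟ j) then 1ℤ else 0ℤ

adjacency : ∀ {n} → Graph n → Matrix ℤ n
adjacency G i j = if adj G i j then 1ℤ else 0ℤ

seidel : ∀ {n} → Graph n → Matrix ℤ n
seidel {n} G i j = J n i j ℤ.- I n i j ℤ.- + 2 ℤ.* adjacency G i j

toℚ : ∀ {n} → Matrix ℤ n → Matrix ℚ n
toℚ M i j = M i j ℚ./ 1

_·_ : ∀ {n} → Matrix ℚ n → Matrix ℚ n → Matrix ℚ n
(M · N) i j = sumℚ λ k → M i k ℚ.* N k j

Inverse : ∀ {n} → Matrix ℚ n → Matrix ℚ n → Set
Inverse {n} M N =
  (∀ i j → (M · N) i j ≡ toℚ (I n) i j) × (∀ i j → (N · M) i j ≡ toℚ (I n) i j)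

-- An integer matrix is singular when it has no inverse over the field ℚ
-- (over ℤ, a non-singular matrix need not have an inverse).
Singular : ∀ {n} → Matrix ℤ n → Set
Singular M = ¬ (∃[ N ] Inverse (toℚ M) N)

_·ᵥ_ : ∀ {n} → Matrix ℤ n → Vector ℤ n → Vector ℤ n
(M ·ᵥ v) i = sumℤ λ j → M i j ℤ.* v j

-- "φ = φ(S)", as a relation: for a singular Seidel matrix S, whose nullspace is
-- one-dimensional, exactly one φ satisfies these conditions.
record IsPhi {n} (S : Matrix ℤ n) (φ : Vector ℤ n) : Set where
  field
    null          : ∀ i → (S ·ᵥ φ) i ≡ 0ℤ
    gcd≡1         : foldr gcd 0ℤ φ ≡ 1ℤ
    firstPositive : ∃[ i ] (0ℤ ℤ.< φ i × (∀ j → j < i → φ j ≡ 0ℤ))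

{-# OPTIONS --safe #-}

-- Let x be the indicator of the smaller sign class of φ, up to a global sign, and
-- p = |x| ≤ 2k, so that ±φ = 𝟙 − 2x and S 𝟙 = 2 S x. As S is symmetric,
--   𝟙ᵀ S 𝟙 = 4 xᵀ S x.
-- Since S = J − I − 2A, the left side is n² − n − 4|E|, while the right side is
-- 4 (p² − p − 2 xᵀ A x) ≤ 4 · 2k (2k − 1); hence |E| ≥ 3k. The Seidel matrix of the
-- complement is −S, so the complement has the same φ, and the lower bound for it is the
-- upper bound for G. In the case of equality the smaller class is an independent set of
-- 2k vertices; the disjoint union of K₁ and k paths P₄, with signs −++− along each path,
-- is such a graph, and its complement attains the upper bound.
module Submission where

open import Defs
open import Data.Nat.Base using (ℕ; _+_; _*_; _^_; _∸_; _≤_)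
open import Data.Integer.Base using (1ℤ; -1ℤ)
open import Data.Product.Base using (_×_; ∃-syntax)
open import Data.Sum.Base using (_⊎_)
open import Relation.Binary.PropositionalEquality.Core using (_≡_)

open import Data.Bool.Base using (Bool; true; false; if_then_else_; not; _∧_; _∨_)
import Data.Bool.Properties as Bool
open import Data.Fin.Base as Fin using (Fin; zero; suc; toℕ; splitAt)
open import Data.Fin.Patterns using (0F; 1F; 2F; 3F)
import Data.Fin.Properties as Fin
open import Data.Integer.Base as ℤ using (ℤ; +_; 0ℤ; +≤+; +<+)
open import Data.Integer.GCD using (gcd)
import Data.Integer.Properties as ℤ
open import Data.Integer.Tactic.RingSolver using (solve-∀)
open import Data.List.Base as List using (_++_; tabulate; cartesianProduct; filter; length)
import Data.List.Properties as List
open import Data.Nat.Base as ℕ using (zero; suc; z≤n; s≤s)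
import Data.Nat.GCD as ℕ
import Data.Nat.Properties as ℕ
import Data.Nat.Tactic.RingSolver as ℕ
open import Data.Product.Base using (_,_)
open import Data.Rational.Base as ℚ using (ℚ)
import Data.Rational.Properties as ℚ
open import Data.Rational.Unnormalised.Base as ℚᵘ using (mkℚᵘ; *≡*)
import Data.Rational.Unnormalised.Properties as ℚᵘ
open import Data.Sum.Base as Sum using (inj₁; inj₂; [_,_]′)
open import Data.Vec.Functional as Vec using (Vector)
open import Function.Base using (_∘_)
open import Relation.Binary.Definitions using (tri<; tri≈; tri>)
open import Relation.Binary.PropositionalEquality
  using (_≢_; refl; sym; trans; cong; cong₂; subst; subst₂; module ≡-Reasoning)
open import Relation.Nullary.Decidable using (does; yes; no; dec-true; dec-false; _×-dec_)
open import Relation.Nullary.Negation using (¬_; contradiction)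
open import Relation.Unary using (Decidable)

open import Algebra.Bundles using (CommutativeRing)
open import Algebra.Properties.Semiring.Sum ℤ.+-*-semiring
  using (sum; sum-cong-≗; sum-replicate-zero; ∑-distrib-+; ∑-comm;
         *-distribˡ-sum; *-distribʳ-sum)
import Algebra.Properties.Semiring.Sum
  (CommutativeRing.semiring ℚ.+-*-commutativeRing) as ∑ℚ

-- Arithmetic of the two bounds

-- With 2k = p + d, the equation amounts to e - 3k = 2pd + (d² - d) + 2m, where every summand is
-- nonnegative because d ≤ d² for natural d. The chain carries the extra terms n + 4p², n = 4k + 1,
-- on both sides so that nothing is subtracted in ℕ.
lowerBound-arith : ∀ k p m e → p ≤ 2 * k →
  (4 * k + 1) * (4 * k + 1) + 4 * p + 8 * m ≡ 4 * e + (4 * k + 1) + 4 * (p * p) →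
  3 * k ≤ e
lowerBound-arith k p m e p≤2k eq = ℕ.*-cancelˡ-≤ 4 (ℕ.+-cancelʳ-≤ (4 * k + 1 + 4 * (p * p)) _ _ (begin
  4 * (3 * k) + (4 * k + 1 + 4 * (p * p))
    ≡⟨ expandˡ k p ⟩
  8 * k + 1 + 4 * (p * p) + 4 * (2 * k)
    ≡⟨ cong (λ t → 8 * k + 1 + 4 * (p * p) + 4 * t) 2k≡p+d ⟩
  8 * k + 1 + 4 * (p * p) + 4 * (p + d)
    ≤⟨ ℕ.+-monoʳ-≤ (8 * k + 1 + 4 * (p * p)) (ℕ.*-monoʳ-≤ 4 (ℕ.+-monoʳ-≤ p (d≤d*d d))) ⟩
  8 * k + 1 + 4 * (p * p) + 4 * (p + d * d)
    ≤⟨ ℕ.m≤m+n _ (8 * (p * d) + 8 * m) ⟩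
  8 * k + 1 + 4 * (p * p) + 4 * (p + d * d) + (8 * (p * d) + 8 * m)
    ≡⟨ square k p d m ⟩
  4 * ((p + d) * (p + d)) + 8 * k + 1 + 4 * p + 8 * m
    ≡⟨ cong (λ t → 4 * (t * t) + 8 * k + 1 + 4 * p + 8 * m) 2k≡p+d ⟨
  4 * (2 * k * (2 * k)) + 8 * k + 1 + 4 * p + 8 * m
    ≡⟨ expandʳ k p m ⟩
  (4 * k + 1) * (4 * k + 1) + 4 * p + 8 * m
    ≡⟨ eq ⟩
  4 * e + (4 * k + 1) + 4 * (p * p)
    ≡⟨ ℕ.+-assoc (4 * e) (4 * k + 1) (4 * (p * p)) ⟩
  4 * e + (4 * k + 1 + 4 * (p * p)) ∎))
  where
  open ℕ.≤-Reasoning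

  d : ℕ
  d = 2 * k ∸ p

  2k≡p+d : 2 * k ≡ p + d
  2k≡p+d = sym (ℕ.m+[n∸m]≡n p≤2k)

  d≤d*d : ∀ d → d ≤ d * d
  d≤d*d zero    = z≤n
  d≤d*d (suc d) = ℕ.m≤m+n (suc d) (d * suc d)

  expandˡ : ∀ k p → 4 * (3 * k) + (4 * k + 1 + 4 * (p * p)) ≡ 8 * k + 1 + 4 * (p * p) + 4 * (2 * k)
  expandˡ = ℕ.solve-∀

  square : ∀ k p d m → 8 * k + 1 + 4 * (p * p) + 4 * (p + d * d) + (8 * (p * d) + 8 * m) ≡
    4 * ((p + d) * (p + d)) + 8 * k + 1 + 4 * p + 8 * m
  square = ℕ.solve-∀

  expandʳ : ∀ k p m → 4 * (2 * k * (2 * k)) + 8 * k + 1 + 4 * p + 8 * m ≡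
    (4 * k + 1) * (4 * k + 1) + 4 * p + 8 * m
  expandʳ = ℕ.solve-∀

-- The order is odd, so the two sign classes cannot both exceed 2k.
smallerHalf : ∀ k {p q} → p + q ≡ 4 * k + 1 → ¬ p ≤ 2 * k → q ≤ 2 * k
smallerHalf k {p} {q} p+q≡4k+1 p≰2k = ℕ.+-cancelˡ-≤ (suc (2 * k)) q (2 * k) (begin
  suc (2 * k) + q      ≤⟨ ℕ.+-monoˡ-≤ q (ℕ.≰⇒> p≰2k) ⟩
  p + q                ≡⟨ p+q≡4k+1 ⟩
  4 * k + 1            ≡⟨ halves k ⟩
  suc (2 * k) + 2 * k  ∎)
  where
  open ℕ.≤-Reasoning

  halves : ∀ k → 4 * k + 1 ≡ suc (2 * k) + 2 * k
  halves = ℕ.solve-∀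

-- Here 8k² + 2k is n(n - 1)/2 for n = 4k + 1, the number of pairs shared out between a graph and
-- its complement. Reaching `e + k ≤ 8 * k ^ 2` first keeps truncated subtraction out of the
-- calculation.
3k-complement-≤ : ∀ k {e e′} → e + e′ ≡ 8 * k ^ 2 + 2 * k → 3 * k ≤ e′ → e ≤ 8 * k ^ 2 ∸ k
3k-complement-≤ k {e} {e′} e+e′ 3k≤e′ =
  ℕ.m+n≤o⇒m≤o∸n e (ℕ.+-cancelʳ-≤ (2 * k) (e + k) (8 * k ^ 2) (begin
  e + k + 2 * k      ≡⟨ ℕ.+-assoc e k (2 * k) ⟩
  e + 3 * k          ≤⟨ ℕ.+-monoʳ-≤ e 3k≤e′ ⟩
  e + e′             ≡⟨ e+e′ ⟩
  8 * k ^ 2 + 2 * k  ∎))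
  where open ℕ.≤-Reasoning

3k-complement-≡ : ∀ k {e e′} → e + e′ ≡ 8 * k ^ 2 + 2 * k → e ≡ 3 * k → e′ ≡ 8 * k ^ 2 ∸ k
3k-complement-≡ k {e} {e′} e+e′ refl = trans (sym (ℕ.m+n∸n≡m e′ k))
  (cong (_∸ k) (ℕ.+-cancelʳ-≡ (2 * k) (e′ + k) (8 * k ^ 2) (trans (rearrange k e′) e+e′)))
  where
  rearrange : ∀ k e → e + k + 2 * k ≡ 3 * k + e
  rearrange = ℕ.solve-∀

open ≡-Reasoning

-- Integer sums, dot products and matrix-vector products

⟦_⟧ : Bool → ℤ
⟦ b ⟧ = if b then 1ℤ else 0ℤ

𝟙 : ∀ {n} → Vector ℤ n
𝟙 _ = 1ℤ

infix 9 _∙_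

_∙_ : ∀ {n} → Vector ℤ n → Vector ℤ n → ℤ
u ∙ v = sum λ i → u i ℤ.* v i

sum-linear : ∀ {n} (u : Vector ℤ n) c (v : Vector ℤ n) →
  sum (λ i → u i ℤ.+ c ℤ.* v i) ≡ sum u ℤ.+ c ℤ.* sum v
sum-linear u c v = begin
  sum (λ i → u i ℤ.+ c ℤ.* v i)      ≡⟨ ∑-distrib-+ u _ ⟩
  sum u ℤ.+ sum (λ i → c ℤ.* v i)    ≡⟨ cong (λ t → sum u ℤ.+ t) (*-distribˡ-sum c v) ⟨
  sum u ℤ.+ c ℤ.* sum v              ∎

sum-𝟙 : ∀ n → sum (𝟙 {n}) ≡ + n
sum-𝟙 zero    = refl
sum-𝟙 (suc n) = cong (λ t → 1ℤ ℤ.+ t) (sum-𝟙 n)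

sum-nonNeg : ∀ {n} (u : Vector ℤ n) → (∀ i → 0ℤ ℤ.≤ u i) → 0ℤ ℤ.≤ sum u
sum-nonNeg {zero}  u 0≤u = ℤ.≤-refl
sum-nonNeg {suc n} u 0≤u = ℤ.+-mono-≤ (0≤u zero) (sum-nonNeg (u ∘ suc) (0≤u ∘ suc))

-- Taking `f` on the sum type fits the recursion of `splitAt`: dropping the first index replaces `f`
-- by `f ∘ Sum.map₁ suc`.
sum-splitAt : ∀ m {n} (f : Fin m ⊎ Fin n → ℤ) →
  sum (f ∘ splitAt m) ≡ sum (f ∘ inj₁) ℤ.+ sum (f ∘ inj₂)
sum-splitAt zero    f = sym (ℤ.+-identityˡ _)
sum-splitAt (suc m) f = trans
  (cong (λ t → f (inj₁ zero) ℤ.+ t) (sum-splitAt m (f ∘ Sum.map₁ suc)))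
  (sym (ℤ.+-assoc (f (inj₁ zero)) _ _))

⟦⟧-nonNeg : ∀ b → 0ℤ ℤ.≤ ⟦ b ⟧
⟦⟧-nonNeg true  = +≤+ z≤n
⟦⟧-nonNeg false = +≤+ z≤n

∙-linear : ∀ {n} (u v : Vector ℤ n) c (w : Vector ℤ n) →
  u ∙ (λ i → v i ℤ.+ c ℤ.* w i) ≡ u ∙ v ℤ.+ c ℤ.* u ∙ w
∙-linear u v c w = trans
  (sum-cong-≗ λ i → rearrange (u i) (v i) c (w i))
  (sum-linear (λ i → u i ℤ.* v i) c (λ i → u i ℤ.* w i))
  where
  rearrange : ∀ a b c d → a ℤ.* (b ℤ.+ c ℤ.* d) ≡ a ℤ.* b ℤ.+ c ℤ.* (a ℤ.* d)
  rearrange = solve-∀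

∙-scale : ∀ {n} (u : Vector ℤ n) c (v : Vector ℤ n) →
  u ∙ (λ i → c ℤ.* v i) ≡ c ℤ.* u ∙ v
∙-scale u c v = trans
  (sum-cong-≗ λ i → rearrange (u i) c (v i))
  (sym (*-distribˡ-sum c (λ i → u i ℤ.* v i)))
  where
  rearrange : ∀ a c d → a ℤ.* (c ℤ.* d) ≡ c ℤ.* (a ℤ.* d)
  rearrange = solve-∀

∙-congʳ : ∀ {n} (u : Vector ℤ n) {v w : Vector ℤ n} → (∀ i → v i ≡ w i) →
  u ∙ v ≡ u ∙ w
∙-congʳ u v≗w = sum-cong-≗ λ i → cong (λ t → u i ℤ.* t) (v≗w i)

-- Both sides are one double sum, read in the two orders of summation, with `M` transposed in
-- between.
∙-selfAdjoint : ∀ {n} (M : Matrix ℤ n) → (∀ i j → M i j ≡ M j i) →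
  ∀ u v → u ∙ (M ·ᵥ v) ≡ v ∙ (M ·ᵥ u)
∙-selfAdjoint M M-sym u v = begin
  sum (λ i → u i ℤ.* (sum λ j → M i j ℤ.* v j))
    ≡⟨ sum-cong-≗ (λ i → *-distribˡ-sum (u i) (λ j → M i j ℤ.* v j)) ⟩
  sum (λ i → sum (λ j → u i ℤ.* (M i j ℤ.* v j)))
    ≡⟨ ∑-comm (λ i j → u i ℤ.* (M i j ℤ.* v j)) ⟩
  sum (λ j → sum (λ i → u i ℤ.* (M i j ℤ.* v j)))
    ≡⟨ sum-cong-≗ (λ j → sum-cong-≗ λ i →
         trans (cong (λ m → u i ℤ.* (m ℤ.* v j)) (M-sym i j)) (rearrange (u i) (M j i) (v j))) ⟩
  sum (λ j → sum (λ i → v j ℤ.* (M j i ℤ.* u i)))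
    ≡⟨ sum-cong-≗ (λ j → *-distribˡ-sum (v j) (λ i → M j i ℤ.* u i)) ⟨
  sum (λ j → v j ℤ.* (sum λ i → M j i ℤ.* u i))
    ∎
  where
  rearrange : ∀ a b c → a ℤ.* (b ℤ.* c) ≡ c ℤ.* (b ℤ.* a)
  rearrange = solve-∀

I-·ᵥ : ∀ {n} (v : Vector ℤ n) i → (I n ·ᵥ v) i ≡ v i
I-·ᵥ {suc n} v zero = begin
  1ℤ ℤ.* v zero ℤ.+ sum {n} (λ _ → 0ℤ)  ≡⟨ cong (λ t → 1ℤ ℤ.* v zero ℤ.+ t) (sum-replicate-zero n) ⟩
  1ℤ ℤ.* v zero ℤ.+ 0ℤ                  ≡⟨ ℤ.+-identityʳ _ ⟩
  1ℤ ℤ.* v zero                         ≡⟨ ℤ.*-identityˡ _ ⟩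
  v zero                                ∎
I-·ᵥ {suc n} v (suc i) = trans (ℤ.+-identityˡ _) (I-·ᵥ (v ∘ suc) i)

-- Null vectors and singularity

-- The normalising division does not compute on a variable numerator, so the claim is moved to
-- unnormalised rationals, where it is a cross-multiplication in ℤ.
/1-+ : ∀ a b → (a ℤ.+ b) ℚ./ 1 ≡ a ℚ./ 1 ℚ.+ b ℚ./ 1
/1-+ a b = ℚ.toℚᵘ-injective (ℚᵘ.≃-trans (ℚ.toℚᵘ-fromℚᵘ (mkℚᵘ (a ℤ.+ b) 0)) (ℚᵘ.≃-trans
  (*≡* (rearrange a b))
  (ℚᵘ.≃-sym (ℚᵘ.≃-trans (ℚ.toℚᵘ-homo-+ (a ℚ./ 1) (b ℚ./ 1))
    (ℚᵘ.+-cong (ℚ.toℚᵘ-fromℚᵘ (mkℚᵘ a 0)) (ℚ.toℚᵘ-fromℚᵘ (mkℚᵘ b 0)))))))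
  where
  rearrange : ∀ a b → (a ℤ.+ b) ℤ.* 1ℤ ≡ (a ℤ.* 1ℤ ℤ.+ b ℤ.* 1ℤ) ℤ.* 1ℤ
  rearrange = solve-∀

/1-* : ∀ a b → (a ℤ.* b) ℚ./ 1 ≡ (a ℚ./ 1) ℚ.* (b ℚ./ 1)
/1-* a b = ℚ.toℚᵘ-injective (ℚᵘ.≃-trans (ℚ.toℚᵘ-fromℚᵘ (mkℚᵘ (a ℤ.* b) 0))
  (ℚᵘ.≃-sym (ℚᵘ.≃-trans (ℚ.toℚᵘ-homo-* (a ℚ./ 1) (b ℚ./ 1))
    (ℚᵘ.*-cong (ℚ.toℚᵘ-fromℚᵘ (mkℚᵘ a 0)) (ℚ.toℚᵘ-fromℚᵘ (mkℚᵘ b 0))))))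

sum-/1 : ∀ {n} (u : Vector ℤ n) → sum u ℚ./ 1 ≡ ∑ℚ.sum (λ i → u i ℚ./ 1)
sum-/1 {zero}  u = refl
sum-/1 {suc n} u = trans (/1-+ (u zero) _) (cong (u zero ℚ./ 1 ℚ.+_) (sum-/1 (u ∘ suc)))

·ᵥ-/1 : ∀ {n} (M : Matrix ℤ n) v i →
  (M ·ᵥ v) i ℚ./ 1 ≡ ∑ℚ.sum (λ j → toℚ M i j ℚ.* (v j ℚ./ 1))
·ᵥ-/1 M v i = trans (sum-/1 λ j → M i j ℤ.* v j) (∑ℚ.sum-cong-≗ λ j → /1-* (M i j) (v j))

-- An inverse N over ℚ would give v = (N M) v = N (M v) = 0, and the embedding of ℤ into ℚ is
-- injective.
nullVector⇒singular : ∀ {n} (M : Matrix ℤ n) v → (∀ i → (M ·ᵥ v) i ≡ 0ℤ) →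
  ∀ i → v i ≢ 0ℤ → Singular M
nullVector⇒singular M v Mv≡0 i vᵢ≢0 (N , _ , NM≡I) = vᵢ≢0 (/1-injective (begin
  v i ℚ./ 1
    ≡⟨ cong (ℚ._/ 1) (I-·ᵥ v i) ⟨
  (I _ ·ᵥ v) i ℚ./ 1
    ≡⟨ ·ᵥ-/1 (I _) v i ⟩
  ∑ℚ.sum (λ j → toℚ (I _) i j ℚ.* w j)
    ≡⟨ ∑ℚ.sum-cong-≗ (λ j → cong (ℚ._* w j) (NM≡I i j)) ⟨
  ∑ℚ.sum (λ j → ∑ℚ.sum (λ k → N i k ℚ.* toℚ M k j) ℚ.* w j)
    ≡⟨ ∑ℚ.sum-cong-≗ (λ j → ∑ℚ.*-distribʳ-sum (w j) (λ k → N i k ℚ.* toℚ M k j)) ⟩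
  ∑ℚ.sum (λ j → ∑ℚ.sum λ k → N i k ℚ.* toℚ M k j ℚ.* w j)
    ≡⟨ ∑ℚ.∑-comm (λ j k → N i k ℚ.* toℚ M k j ℚ.* w j) ⟩
  ∑ℚ.sum (λ k → ∑ℚ.sum λ j → N i k ℚ.* toℚ M k j ℚ.* w j)
    ≡⟨ ∑ℚ.sum-cong-≗ (λ k → ∑ℚ.sum-cong-≗ λ j → ℚ.*-assoc (N i k) (toℚ M k j) (w j)) ⟩
  ∑ℚ.sum (λ k → ∑ℚ.sum λ j → N i k ℚ.* (toℚ M k j ℚ.* w j))
    ≡⟨ ∑ℚ.sum-cong-≗ (λ k → ∑ℚ.*-distribˡ-sum (N i k) (λ j → toℚ M k j ℚ.* w j)) ⟨
  ∑ℚ.sum (λ k → N i k ℚ.* ∑ℚ.sum λ j → toℚ M k j ℚ.* w j)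
    ≡⟨ ∑ℚ.sum-cong-≗ (λ k → cong (N i k ℚ.*_) (trans (sym (·ᵥ-/1 M v k)) (cong (ℚ._/ 1) (Mv≡0 k)))) ⟩
  ∑ℚ.sum (λ k → N i k ℚ.* ℚ.0ℚ)
    ≡⟨ ∑ℚ.*-distribʳ-sum ℚ.0ℚ (N i) ⟨
  ∑ℚ.sum (N i) ℚ.* ℚ.0ℚ
    ≡⟨ ℚ.*-zeroʳ (∑ℚ.sum (N i)) ⟩
  ℚ.0ℚ ∎))
  where
  w : Vector ℚ _
  w j = v j ℚ./ 1

  /1-injective : ∀ {a} → a ℚ./ 1 ≡ ℚ.0ℚ → a ≡ 0ℤ
  /1-injective {a} eq with ℚ.fromℚᵘ-injective {mkℚᵘ a 0} {mkℚᵘ 0ℤ 0} eq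
  ... | *≡* a*1≡0 = trans (sym (ℤ.*-identityʳ a)) a*1≡0

-- Counting edges

+length-filter-tabulate : ∀ {A : Set} {P : A → Set} (P? : Decidable P) {n} (f : Fin n → A) →
  + length (filter P? (tabulate f)) ≡ sum (λ i → ⟦ does (P? (f i)) ⟧)
+length-filter-tabulate P? {zero}  f = refl
+length-filter-tabulate P? {suc n} f with does (P? (f zero))
... | false = trans (+length-filter-tabulate P? (f ∘ suc)) (sym (ℤ.+-identityˡ _))
... | true  = cong (λ t → 1ℤ ℤ.+ t) (+length-filter-tabulate P? (f ∘ suc))

+length-filter-product : ∀ {A B : Set} {P : A × B → Set} (P? : Decidable P) {m n}
  (f : Fin m → A) (g : Fin n → B) →
  + length (filter P? (cartesianProduct (tabulate f) (tabulate g))) ≡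
  sum (λ i → sum (λ j → ⟦ does (P? (f i , g j)) ⟧))
+length-filter-product P? {zero}  f g = refl
+length-filter-product P? {suc m} {n} f g = begin
  + length (filter P? (row ++ rest))
    ≡⟨ cong (+_ ∘ length) (List.filter-++ P? row rest) ⟩
  + length (filter P? row ++ filter P? rest)
    ≡⟨ cong +_ (List.length-++ (filter P? row)) ⟩
  + length (filter P? row) ℤ.+ + length (filter P? rest)
    ≡⟨ cong₂ ℤ._+_
         (trans (cong (+_ ∘ length ∘ filter P?) (List.map-tabulate g (f zero ,_)))
                (+length-filter-tabulate P? (λ j → f zero , g j)))
         (+length-filter-product P? (f ∘ suc) g) ⟩
  sum (λ i → sum (λ j → ⟦ does (P? (f i , g j)) ⟧)) ∎
  where
  row  = List.map (f zero ,_) (tabulate g)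
  rest = cartesianProduct (tabulate (f ∘ suc)) (tabulate g)

-- The adjacency matrix is its strict upper triangle plus the transpose of that, the diagonal being
-- zero. The triangle is what `edges` lists, and exchanging the summations shows that both halves
-- have the same sum.
adjacency-sum : ∀ {n} (G : Graph n) →
  sum (λ i → sum (λ j → adjacency G i j)) ≡ + 2 ℤ.* + ∣E G ∣
adjacency-sum {n} G = begin
  sum (λ i → sum (λ j → adjacency G i j))
    ≡⟨ sum-cong-≗ (λ i → trans (sum-cong-≗ (split i)) (∑-distrib-+ (above i) (λ j → above j i))) ⟩
  sum (λ i → sum (above i) ℤ.+ (sum λ j → above j i))
    ≡⟨ ∑-distrib-+ (λ i → sum (above i)) _ ⟩
  (sum λ i → sum (above i)) ℤ.+ (sum λ i → sum (λ j → above j i))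
    ≡⟨ cong (λ t → (sum λ i → sum (above i)) ℤ.+ t) (∑-comm (λ i j → above j i)) ⟩
  (sum λ i → sum (above i)) ℤ.+ (sum λ i → sum (above i))
    ≡⟨ double _ ⟩
  + 2 ℤ.* (sum λ i → sum (above i))
    ≡⟨ cong (λ t → + 2 ℤ.* t) (+length-filter-product edge? (λ i → i) (λ j → j)) ⟨
  + 2 ℤ.* + ∣E G ∣ ∎
  where
  -- This repeats the test inside `edges`, so that `∣E G ∣` unfolds to the length of a list filtered
  -- by `edge?`.
  edge? : Decidable (λ ((i , j) : Fin n × Fin n) → i Fin.< j × adj G i j ≡ true)
  edge? (i , j) = (i Fin.<? j) ×-dec (adj G i j Bool.≟ true)

  above : Matrix ℤ n
  above i j = ⟦ does (edge? (i , j)) ⟧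

  does-≟true : ∀ b → does (b Bool.≟ true) ≡ b
  does-≟true true  = refl
  does-≟true false = refl

  above-< : ∀ {i j} → i Fin.< j → above i j ≡ adjacency G i j
  above-< {i} {j} i<j rewrite dec-true (i Fin.<? j) i<j = cong ⟦_⟧ (does-≟true (adj G i j))

  above-≮ : ∀ {i j} → ¬ i Fin.< j → above i j ≡ 0ℤ
  above-≮ {i} {j} i≮j rewrite dec-false (i Fin.<? j) i≮j = refl

  split : ∀ i j → adjacency G i j ≡ above i j ℤ.+ above j i
  split i j with Fin.<-cmp i j
  ... | tri< i<j _ j≮i = trans (sym (ℤ.+-identityʳ _)) (sym (cong₂ ℤ._+_ (above-< i<j) (above-≮ j≮i)))
  ... | tri≈ i≮i refl _ = trans (cong ⟦_⟧ (irrefl G i)) (sym (cong₂ ℤ._+_ (above-≮ i≮i) (above-≮ i≮i)))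
  ... | tri> i≮j _ j<i = trans (cong ⟦_⟧ (symm G i j))
    (trans (sym (ℤ.+-identityˡ _)) (sym (cong₂ ℤ._+_ (above-≮ i≮j) (above-< j<i))))

  double : ∀ a → a ℤ.+ a ≡ + 2 ℤ.* a
  double = solve-∀

-- The handshake lemma: `adjacency G ·ᵥ 𝟙` is the vector of degrees.
degreeSum : ∀ {n} (G : Graph n) → sum (adjacency G ·ᵥ 𝟙) ≡ + (2 * ∣E G ∣)
degreeSum G = trans
  (sum-cong-≗ λ i → sum-cong-≗ λ j → ℤ.*-identityʳ (adjacency G i j))
  (trans (adjacency-sum G) (sym (ℤ.pos-* 2 ∣E G ∣)))

-- The Seidel matrix

does-≟-sym : ∀ {n} (i j : Fin n) → does (i Fin.≟ j) ≡ does (j Fin.≟ i)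
does-≟-sym i j with i Fin.≟ j
... | yes i≡j = sym (dec-true (j Fin.≟ i) (sym i≡j))
... | no  i≢j = sym (dec-false (j Fin.≟ i) (i≢j ∘ sym))

seidel-sym : ∀ {n} (G : Graph n) i j → seidel G i j ≡ seidel G j i
seidel-sym G i j = cong₂ (λ b c → 1ℤ ℤ.- ⟦ b ⟧ ℤ.- + 2 ℤ.* ⟦ c ⟧) (does-≟-sym i j) (symm G i j)
seidel-·ᵥ : ∀ {n} (G : Graph n) v i →
  (seidel G ·ᵥ v) i ≡ sum v ℤ.- v i ℤ.- + 2 ℤ.* (adjacency G ·ᵥ v) i
seidel-·ᵥ {n} G v i = begin
  (seidel G ·ᵥ v) i
    ≡⟨ sum-cong-≗ (λ j → expand (I n i j) (adjacency G i j) (v j)) ⟩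
  sum (λ j → (v j ℤ.+ -1ℤ ℤ.* (I n i j ℤ.* v j)) ℤ.+ ℤ.- + 2 ℤ.* (adjacency G i j ℤ.* v j))
    ≡⟨ sum-linear (λ j → v j ℤ.+ -1ℤ ℤ.* (I n i j ℤ.* v j)) (ℤ.- + 2) (λ j → adjacency G i j ℤ.* v j) ⟩
  sum (λ j → v j ℤ.+ -1ℤ ℤ.* (I n i j ℤ.* v j)) ℤ.+ ℤ.- + 2 ℤ.* (adjacency G ·ᵥ v) i
    ≡⟨ cong (ℤ._+ ℤ.- + 2 ℤ.* (adjacency G ·ᵥ v) i) (sum-linear v -1ℤ (λ j → I n i j ℤ.* v j)) ⟩
  (sum v ℤ.+ -1ℤ ℤ.* (I n ·ᵥ v) i) ℤ.+ ℤ.- + 2 ℤ.* (adjacency G ·ᵥ v) i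
    ≡⟨ cong (λ t → (sum v ℤ.+ -1ℤ ℤ.* t) ℤ.+ ℤ.- + 2 ℤ.* (adjacency G ·ᵥ v) i) (I-·ᵥ v i) ⟩
  (sum v ℤ.+ -1ℤ ℤ.* v i) ℤ.+ ℤ.- + 2 ℤ.* (adjacency G ·ᵥ v) i
    ≡⟨ collect (sum v) (v i) ((adjacency G ·ᵥ v) i) ⟩
  sum v ℤ.- v i ℤ.- + 2 ℤ.* (adjacency G ·ᵥ v) i ∎
  where
  expand : ∀ a b c → (1ℤ ℤ.- a ℤ.- + 2 ℤ.* b) ℤ.* c ≡
                     (c ℤ.+ -1ℤ ℤ.* (a ℤ.* c)) ℤ.+ ℤ.- + 2 ℤ.* (b ℤ.* c)
  expand = solve-∀

  collect : ∀ a b c → (a ℤ.+ -1ℤ ℤ.* b) ℤ.+ ℤ.- + 2 ℤ.* c ≡ a ℤ.- b ℤ.- + 2 ℤ.* c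
  collect = solve-∀

-- The matrix J contributes the square of the sum, since J v is constant with value `sum v`.
seidel-form : ∀ {n} (G : Graph n) v →
  v ∙ (seidel G ·ᵥ v) ≡
  sum v ℤ.* sum v ℤ.- v ∙ v ℤ.- + 2 ℤ.* v ∙ (adjacency G ·ᵥ v)
seidel-form G v = begin
  v ∙ S
    ≡⟨ ∙-congʳ v (λ i → trans (seidel-·ᵥ G v i) (expand (sum v) (v i) (A i))) ⟩
  v ∙ (λ i → (sum v ℤ.+ -1ℤ ℤ.* v i) ℤ.+ ℤ.- + 2 ℤ.* A i)
    ≡⟨ ∙-linear v (λ i → sum v ℤ.+ -1ℤ ℤ.* v i) (ℤ.- + 2) A ⟩
  v ∙ (λ i → sum v ℤ.+ -1ℤ ℤ.* v i) ℤ.+ ℤ.- + 2 ℤ.* v ∙ A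
    ≡⟨ cong (ℤ._+ ℤ.- + 2 ℤ.* v ∙ A) (∙-linear v (λ _ → sum v) -1ℤ v) ⟩
  v ∙ (λ _ → sum v) ℤ.+ -1ℤ ℤ.* v ∙ v ℤ.+ ℤ.- + 2 ℤ.* v ∙ A
    ≡⟨ cong (λ t → t ℤ.+ -1ℤ ℤ.* v ∙ v ℤ.+ ℤ.- + 2 ℤ.* v ∙ A) (*-distribʳ-sum (sum v) v) ⟨
  sum v ℤ.* sum v ℤ.+ -1ℤ ℤ.* v ∙ v ℤ.+ ℤ.- + 2 ℤ.* v ∙ A
    ≡⟨ expand (sum v ℤ.* sum v) (v ∙ v) (v ∙ A) ⟨
  sum v ℤ.* sum v ℤ.- v ∙ v ℤ.- + 2 ℤ.* v ∙ A ∎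
  where
  S = seidel G ·ᵥ v
  A = adjacency G ·ᵥ v

  expand : ∀ a b c → a ℤ.- b ℤ.- + 2 ℤ.* c ≡ (a ℤ.+ -1ℤ ℤ.* b) ℤ.+ ℤ.- + 2 ℤ.* c
  expand = solve-∀

-- This is the sum of all entries of S: there are n² - n off-diagonal positions, and each edge turns
-- two of them from 1 into -1.
seidel-total : ∀ {n} (G : Graph n) →
  𝟙 ∙ (seidel G ·ᵥ 𝟙) ≡ + n ℤ.* + n ℤ.- + n ℤ.- + 4 ℤ.* + ∣E G ∣
seidel-total {n} G = begin
  𝟙 ∙ (seidel G ·ᵥ 𝟙)
    ≡⟨ seidel-form G 𝟙 ⟩
  sum (𝟙 {n}) ℤ.* sum (𝟙 {n}) ℤ.- sum (𝟙 {n}) ℤ.- + 2 ℤ.* 𝟙 ∙ (adjacency G ·ᵥ 𝟙)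
    ≡⟨ cong₂ (λ s a → s ℤ.* s ℤ.- s ℤ.- + 2 ℤ.* a) (sum-𝟙 n) 𝟙∙A𝟙 ⟩
  + n ℤ.* + n ℤ.- + n ℤ.- + 2 ℤ.* (+ 2 ℤ.* + ∣E G ∣)
    ≡⟨ cong (λ t → + n ℤ.* + n ℤ.- + n ℤ.- t) (sym (ℤ.*-assoc (+ 2) (+ 2) (+ ∣E G ∣))) ⟩
  + n ℤ.* + n ℤ.- + n ℤ.- + 4 ℤ.* + ∣E G ∣ ∎
  where
  𝟙∙A𝟙 : 𝟙 ∙ (adjacency G ·ᵥ 𝟙) ≡ + 2 ℤ.* + ∣E G ∣
  𝟙∙A𝟙 = trans (sum-cong-≗ λ i → ℤ.*-identityˡ ((adjacency G ·ᵥ 𝟙) i))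
    (trans (degreeSum G) (ℤ.pos-* 2 ∣E G ∣))

-- Complements

complement : ∀ {n} → Graph n → Graph n
complement G .adj i j    = not (does (i Fin.≟ j)) ∧ not (adj G i j)
complement G .symm i j   = cong₂ (λ b c → not b ∧ not c) (does-≟-sym i j) (symm G i j)
complement G .irrefl i   = cong (λ b → not b ∧ not (adj G i i)) (dec-true (i Fin.≟ i) refl)

-- Off the diagonal an entry is 1 or -1 according to adjacency, so complementing flips it; on the
-- diagonal it is 0 by looplessness. Abstracting the two Booleans lets each case compute.
seidel-complement : ∀ {n} (G : Graph n) i j → seidel (complement G) i j ≡ ℤ.- seidel G i j
seidel-complement G i j = entry (does (i Fin.≟ j)) (adj G i j) loopless
  where
  entry : ∀ d a → (d ≡ true → a ≡ false) →
    1ℤ ℤ.- ⟦ d ⟧ ℤ.- + 2 ℤ.* ⟦ not d ∧ not a ⟧ ≡ ℤ.- (1ℤ ℤ.- ⟦ d ⟧ ℤ.- + 2 ℤ.* ⟦ a ⟧)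
  entry true  true  d⇒¬a = contradiction (d⇒¬a refl) λ ()
  entry true  false d⇒¬a = refl
  entry false true  d⇒¬a = refl
  entry false false d⇒¬a = refl

  loopless : does (i Fin.≟ j) ≡ true → adj G i j ≡ false
  loopless d≡true with i Fin.≟ j
  ... | yes refl = irrefl G i
  loopless () | no _

seidel-complement-·ᵥ : ∀ {n} (G : Graph n) v i →
  (seidel (complement G) ·ᵥ v) i ≡ -1ℤ ℤ.* (seidel G ·ᵥ v) i
seidel-complement-·ᵥ G v i = trans
  (sum-cong-≗ λ j → trans (cong (λ t → t ℤ.* v j) (seidel-complement G i j)) (rearrange (seidel G i j) (v j)))
  (sym (*-distribˡ-sum -1ℤ (λ j → seidel G i j ℤ.* v j)))
  where
  rearrange : ∀ a b → (ℤ.- a) ℤ.* b ≡ -1ℤ ℤ.* (a ℤ.* b)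
  rearrange = solve-∀

complement-null : ∀ {n} (G : Graph n) φ → (∀ i → (seidel G ·ᵥ φ) i ≡ 0ℤ) →
  ∀ i → (seidel (complement G) ·ᵥ φ) i ≡ 0ℤ
complement-null G φ Sφ≡0 i = trans (seidel-complement-·ᵥ G φ i) (cong (λ t → -1ℤ ℤ.* t) (Sφ≡0 i))

-- No pairs are counted: the Seidel matrices of G and its complement are negatives of each other, so
-- their entry sums n² - n - 4e and n² - n - 4e′ add up to zero.
edges-complement : ∀ {n} (G : Graph n) → 2 * (∣E G ∣ + ∣E complement G ∣) + n ≡ n * n
edges-complement {n} G = ℕ.*-cancelˡ-≡ _ _ 2 (ℤ.+-injective (begin
  + (2 * (2 * (e + e′) + n))
    ≡⟨ trans (ℤ.pos-* 2 (2 * (e + e′) + n)) (cong (λ t → + 2 ℤ.* (t ℤ.+ + n)) (ℤ.pos-* 2 (e + e′))) ⟩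
  + 2 ℤ.* (+ 2 ℤ.* (+ e ℤ.+ + e′) ℤ.+ + n)
    ≡⟨ rearrange (+ e) (+ e′) (+ n) ⟩
  (+ 2 ℤ.* (+ n ℤ.* + n) ℤ.- total e) ℤ.+ -1ℤ ℤ.* total e′
    ≡⟨ cong (λ t → (+ 2 ℤ.* (+ n ℤ.* + n) ℤ.- total e) ℤ.+ -1ℤ ℤ.* t) total-complement ⟩
  (+ 2 ℤ.* (+ n ℤ.* + n) ℤ.- total e) ℤ.+ -1ℤ ℤ.* (-1ℤ ℤ.* total e)
    ≡⟨ cancel (+ 2 ℤ.* (+ n ℤ.* + n)) (total e) ⟩
  + 2 ℤ.* (+ n ℤ.* + n)
    ≡⟨ trans (ℤ.pos-* 2 (n * n)) (cong (λ t → + 2 ℤ.* t) (ℤ.pos-* n n)) ⟨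
  + (2 * (n * n)) ∎))
  where
  e  = ∣E G ∣
  e′ = ∣E complement G ∣

  total : ℕ → ℤ
  total e = + n ℤ.* + n ℤ.- + n ℤ.- + 4 ℤ.* + e

  total-complement : total e′ ≡ -1ℤ ℤ.* total e
  total-complement = begin
    total e′
      ≡⟨ seidel-total (complement G) ⟨
    𝟙 ∙ (seidel (complement G) ·ᵥ 𝟙)
      ≡⟨ ∙-congʳ 𝟙 (seidel-complement-·ᵥ G 𝟙) ⟩
    𝟙 ∙ (λ i → -1ℤ ℤ.* (seidel G ·ᵥ 𝟙) i)
      ≡⟨ ∙-scale 𝟙 -1ℤ (seidel G ·ᵥ 𝟙) ⟩
    -1ℤ ℤ.* (𝟙 ∙ (seidel G ·ᵥ 𝟙))
      ≡⟨ cong (λ t → -1ℤ ℤ.* t) (seidel-total G) ⟩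
    -1ℤ ℤ.* total e ∎

  rearrange : ∀ e e′ n → + 2 ℤ.* (+ 2 ℤ.* (e ℤ.+ e′) ℤ.+ n) ≡
    (+ 2 ℤ.* (n ℤ.* n) ℤ.- (n ℤ.* n ℤ.- n ℤ.- + 4 ℤ.* e)) ℤ.+ -1ℤ ℤ.* (n ℤ.* n ℤ.- n ℤ.- + 4 ℤ.* e′)
  rearrange = solve-∀

  cancel : ∀ a b → (a ℤ.- b) ℤ.+ -1ℤ ℤ.* (-1ℤ ℤ.* b) ≡ a
  cancel = solve-∀

edges-complement-4k+1 : ∀ k (G : Graph (4 * k + 1)) →
  ∣E G ∣ + ∣E complement G ∣ ≡ 8 * k ^ 2 + 2 * k
edges-complement-4k+1 k G =
  ℕ.*-cancelˡ-≡ _ _ 2 (ℕ.+-cancelʳ-≡ (4 * k + 1) _ _ (trans (edges-complement G) (expand k)))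
  where
  -- The factor `k * (k * 1)` is what `k ^ 2` unfolds to.
  expand : ∀ k → (4 * k + 1) * (4 * k + 1) ≡ 2 * (8 * (k * (k * 1)) + 2 * k) + (4 * k + 1)
  expand = ℕ.solve-∀

-- The lower bound

module _ {n} (G : Graph n) (b : Fin n → Bool) where

  private
    x : Vector ℤ n
    x i = ⟦ b i ⟧

  ∙-indicator : x ∙ x ≡ sum x
  ∙-indicator = sum-cong-≗ λ i → idem (b i)
    where
    idem : ∀ c → ⟦ c ⟧ ℤ.* ⟦ c ⟧ ≡ ⟦ c ⟧
    idem true  = refl
    idem false = refl

  -- The quantity xᵀ A x is twice the number of edges inside the set marked by `b`.
  inducedDegreeSum-nonNeg : 0ℤ ℤ.≤ x ∙ (adjacency G ·ᵥ x)
  inducedDegreeSum-nonNeg = sum-nonNeg _ λ i → ⟦⟧*-nonNeg (b i) (sum-nonNeg _ λ j →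
    ⟦⟧*-nonNeg (adj G i j) (⟦⟧-nonNeg (b j)))
    where
    ⟦⟧*-nonNeg : ∀ c {a} → 0ℤ ℤ.≤ a → 0ℤ ℤ.≤ ⟦ c ⟧ ℤ.* a
    ⟦⟧*-nonNeg true  {a} 0≤a = ℤ.≤-trans 0≤a (ℤ.≤-reflexive (sym (ℤ.*-identityˡ a)))
    ⟦⟧*-nonNeg false 0≤a = +≤+ z≤n

  -- The hypothesis is S (𝟙 - 2x) = 0. Using it on the right, then, after a transposition, once more
  -- gives 𝟙ᵀ S 𝟙 = 2 𝟙ᵀ S x = 2 xᵀ S 𝟙 = 4 xᵀ S x.
  seidel-total-indicator : (∀ i → (seidel G ·ᵥ 𝟙) i ≡ + 2 ℤ.* (seidel G ·ᵥ x) i) →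
    𝟙 ∙ (seidel G ·ᵥ 𝟙) ≡ + 4 ℤ.* x ∙ (seidel G ·ᵥ x)
  seidel-total-indicator S𝟙≡2Sx = begin
    𝟙 ∙ S𝟙                         ≡⟨ ∙-congʳ 𝟙 S𝟙≡2Sx ⟩
    𝟙 ∙ (λ i → + 2 ℤ.* Sx i)       ≡⟨ ∙-scale 𝟙 (+ 2) Sx ⟩
    + 2 ℤ.* 𝟙 ∙ Sx                 ≡⟨ cong (λ t → + 2 ℤ.* t) (∙-selfAdjoint (seidel G) (seidel-sym G) 𝟙 x) ⟩
    + 2 ℤ.* x ∙ S𝟙                 ≡⟨ cong (λ t → + 2 ℤ.* t) (trans (∙-congʳ x S𝟙≡2Sx) (∙-scale x (+ 2) Sx)) ⟩
    + 2 ℤ.* (+ 2 ℤ.* x ∙ Sx)       ≡⟨ ℤ.*-assoc (+ 2) (+ 2) (x ∙ Sx) ⟨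
    + 4 ℤ.* x ∙ Sx                 ∎
    where
    S𝟙 = seidel G ·ᵥ 𝟙
    Sx = seidel G ·ᵥ x

  -- This is n² - n - 4|E| = 4 (p² - p - 2m) with m = xᵀ A x, its negative terms moved across so
  -- that it can be stated in ℕ. Nonnegativity of xᵀ A x makes m a natural number.
  edges-indicator : (∀ i → (seidel G ·ᵥ 𝟙) i ≡ + 2 ℤ.* (seidel G ·ᵥ x) i) →
    ∀ p → sum x ≡ + p →
    ∃[ m ] n * n + 4 * p + 8 * m ≡ 4 * ∣E G ∣ + n + 4 * (p * p)
  edges-indicator S𝟙≡2Sx p Σx≡p = m , ℤ.+-injective (begin
    + (n * n + 4 * p + 8 * m)
      ≡⟨ cong₂ ℤ._+_ (cong₂ ℤ._+_ (ℤ.pos-* n n) (ℤ.pos-* 4 p)) (ℤ.pos-* 8 m) ⟩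
    N ℤ.* N ℤ.+ + 4 ℤ.* P ℤ.+ + 8 ℤ.* + m
      ≡⟨ cong (λ t → N ℤ.* N ℤ.+ + 4 ℤ.* P ℤ.+ + 8 ℤ.* t) (ℤ.0≤i⇒+∣i∣≡i inducedDegreeSum-nonNeg) ⟩
    N ℤ.* N ℤ.+ + 4 ℤ.* P ℤ.+ + 8 ℤ.* xAx
      -- A ring identity exposes the difference of the two expressions equated by `totals`; it then
      -- cancels and leaves `target`.
      ≡⟨ fromTotal N P E xAx ⟩
    (N ℤ.* N ℤ.- N ℤ.- + 4 ℤ.* E) ℤ.- + 4 ℤ.* form ℤ.+ target
      ≡⟨ cong (λ t → t ℤ.- + 4 ℤ.* form ℤ.+ target) totals ⟩
    + 4 ℤ.* form ℤ.- + 4 ℤ.* form ℤ.+ target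
      ≡⟨ cancel (+ 4 ℤ.* form) target ⟩
    target
      ≡⟨ cong₂ ℤ._+_ (cong (λ t → t ℤ.+ N) (ℤ.pos-* 4 ∣E G ∣))
                     (trans (ℤ.pos-* 4 (p * p)) (cong (λ t → + 4 ℤ.* t) (ℤ.pos-* p p))) ⟨
    + (4 * ∣E G ∣ + n + 4 * (p * p)) ∎)
    where
    xAx    = x ∙ (adjacency G ·ᵥ x)
    m      = ℤ.∣ xAx ∣
    N      = + n
    P      = + p
    E      = + ∣E G ∣
    form   = P ℤ.* P ℤ.- P ℤ.- + 2 ℤ.* xAx
    target = + 4 ℤ.* E ℤ.+ N ℤ.+ + 4 ℤ.* (P ℤ.* P)

    totals : N ℤ.* N ℤ.- N ℤ.- + 4 ℤ.* E ≡ + 4 ℤ.* form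
    totals = begin
      N ℤ.* N ℤ.- N ℤ.- + 4 ℤ.* E
        ≡⟨ seidel-total G ⟨
      𝟙 ∙ (seidel G ·ᵥ 𝟙)
        ≡⟨ seidel-total-indicator S𝟙≡2Sx ⟩
      + 4 ℤ.* x ∙ (seidel G ·ᵥ x)
        ≡⟨ cong (λ t → + 4 ℤ.* t) (seidel-form G x) ⟩
      + 4 ℤ.* (sum x ℤ.* sum x ℤ.- x ∙ x ℤ.- + 2 ℤ.* xAx)
        ≡⟨ cong (λ t → + 4 ℤ.* (sum x ℤ.* sum x ℤ.- t ℤ.- + 2 ℤ.* xAx)) ∙-indicator ⟩
      + 4 ℤ.* (sum x ℤ.* sum x ℤ.- sum x ℤ.- + 2 ℤ.* xAx)
        ≡⟨ cong (λ t → + 4 ℤ.* (t ℤ.* t ℤ.- t ℤ.- + 2 ℤ.* xAx)) Σx≡p ⟩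
      + 4 ℤ.* form ∎

    fromTotal : ∀ n p e a → n ℤ.* n ℤ.+ + 4 ℤ.* p ℤ.+ + 8 ℤ.* a ≡
      (n ℤ.* n ℤ.- n ℤ.- + 4 ℤ.* e) ℤ.- + 4 ℤ.* (p ℤ.* p ℤ.- p ℤ.- + 2 ℤ.* a) ℤ.+
      (+ 4 ℤ.* e ℤ.+ n ℤ.+ + 4 ℤ.* (p ℤ.* p))
    fromTotal = solve-∀

    cancel : ∀ a b → a ℤ.- a ℤ.+ b ≡ b
    cancel = solve-∀

Signs : ∀ {n} → Vector ℤ n → Set
Signs φ = ∀ i → φ i ≡ 1ℤ ⊎ φ i ≡ -1ℤ

-- The sign is read off the proof instead of being decided, so that it computes under `-sign`.
negative : ∀ {a} → a ≡ 1ℤ ⊎ a ≡ -1ℤ → Bool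
negative (inj₁ _) = false
negative (inj₂ _) = true

-- With x marking the entries -1 of φ, φ = 𝟙 - 2x, so S φ = 0 turns into the hypothesis S 𝟙 = 2 S x
-- of `edges-indicator`.
minority-bound : ∀ k (G : Graph (4 * k + 1)) φ → (∀ i → (seidel G ·ᵥ φ) i ≡ 0ℤ) →
  (sgn : Signs φ) → ∀ p → sum (λ i → ⟦ negative (sgn i) ⟧) ≡ + p → p ≤ 2 * k → 3 * k ≤ ∣E G ∣
minority-bound k G φ Sφ≡0 sgn p Σx≡p p≤2k =
  let m , eq = edges-indicator G (negative ∘ sgn) S𝟙≡2Sx p Σx≡p
  in lowerBound-arith k p m ∣E G ∣ p≤2k eq
  where
  x : Vector ℤ (4 * k + 1)
  x i = ⟦ negative (sgn i) ⟧

  φ+2x≡1 : ∀ {a} (s : a ≡ 1ℤ ⊎ a ≡ -1ℤ) → 1ℤ ≡ a ℤ.+ + 2 ℤ.* ⟦ negative s ⟧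
  φ+2x≡1 (inj₁ refl) = refl
  φ+2x≡1 (inj₂ refl) = refl

  S𝟙≡2Sx : ∀ i → (seidel G ·ᵥ 𝟙) i ≡ + 2 ℤ.* (seidel G ·ᵥ x) i
  S𝟙≡2Sx i = begin
    (seidel G ·ᵥ 𝟙) i
      ≡⟨ ∙-congʳ (seidel G i) (λ j → φ+2x≡1 (sgn j)) ⟩
    seidel G i ∙ (λ j → φ j ℤ.+ + 2 ℤ.* x j)
      ≡⟨ ∙-linear (seidel G i) φ (+ 2) x ⟩
    (seidel G ·ᵥ φ) i ℤ.+ + 2 ℤ.* (seidel G ·ᵥ x) i
      ≡⟨ cong (λ t → t ℤ.+ + 2 ℤ.* (seidel G ·ᵥ x) i) (Sφ≡0 i) ⟩
    0ℤ ℤ.+ + 2 ℤ.* (seidel G ·ᵥ x) i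
      ≡⟨ ℤ.+-identityˡ _ ⟩
    + 2 ℤ.* (seidel G ·ᵥ x) i ∎

-sign : ∀ {a} → a ≡ 1ℤ ⊎ a ≡ -1ℤ → -1ℤ ℤ.* a ≡ 1ℤ ⊎ -1ℤ ℤ.* a ≡ -1ℤ
-sign (inj₁ refl) = inj₂ refl
-sign (inj₂ refl) = inj₁ refl

negative-count : ∀ {n} {φ : Vector ℤ n} (sgn : Signs φ) →
  ∃[ p ] sum (λ i → ⟦ negative (sgn i) ⟧) ≡ + p
negative-count sgn = _ , sym (ℤ.0≤i⇒+∣i∣≡i (sum-nonNeg _ λ i → ⟦⟧-nonNeg (negative (sgn i))))

-- Each index is negative in exactly one of φ and -φ.
negative-count-+ : ∀ {n} {φ : Vector ℤ n} (sgn : Signs φ) {p q} →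
  sum (λ i → ⟦ negative (sgn i) ⟧) ≡ + p →
  sum (λ i → ⟦ negative (-sign (sgn i)) ⟧) ≡ + q → p + q ≡ n
negative-count-+ {n} sgn {p} {q} Σ≡p Σ≡q = ℤ.+-injective (begin
  + p ℤ.+ + q
    ≡⟨ cong₂ ℤ._+_ Σ≡p Σ≡q ⟨
  sum (λ i → ⟦ negative (sgn i) ⟧) ℤ.+ sum (λ i → ⟦ negative (-sign (sgn i)) ⟧)
    ≡⟨ ∑-distrib-+ (λ i → ⟦ negative (sgn i) ⟧) (λ i → ⟦ negative (-sign (sgn i)) ⟧) ⟨
  sum (λ i → ⟦ negative (sgn i) ⟧ ℤ.+ ⟦ negative (-sign (sgn i)) ⟧)
    ≡⟨ sum-cong-≗ (λ i → exactlyOne (sgn i)) ⟩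
  sum (𝟙 {n})
    ≡⟨ sum-𝟙 n ⟩
  + n ∎)
  where
  exactlyOne : ∀ {a} (s : a ≡ 1ℤ ⊎ a ≡ -1ℤ) → ⟦ negative s ⟧ ℤ.+ ⟦ negative (-sign s) ⟧ ≡ 1ℤ
  exactlyOne (inj₁ refl) = refl
  exactlyOne (inj₂ refl) = refl

-- Since -φ is again a null sign vector, the bound is applied to whichever of φ and -φ has at most
-- 2k negative entries.
edges-lowerBound : ∀ k (G : Graph (4 * k + 1)) φ → (∀ i → (seidel G ·ᵥ φ) i ≡ 0ℤ) →
  Signs φ → 3 * k ≤ ∣E G ∣
edges-lowerBound k G φ Sφ≡0 sgn
  with p , Σ≡p ← negative-count sgn
  with q , Σ≡q ← negative-count (-sign ∘ sgn)
  with p ℕ.≤? 2 * k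
... | yes p≤2k = minority-bound k G φ Sφ≡0 sgn p Σ≡p p≤2k
... | no  p≰2k = minority-bound k G (λ i → -1ℤ ℤ.* φ i) S-φ≡0 (-sign ∘ sgn) q Σ≡q
  (smallerHalf k (negative-count-+ sgn Σ≡p Σ≡q) p≰2k)
  where
  S-φ≡0 : ∀ i → (seidel G ·ᵥ (λ j → -1ℤ ℤ.* φ j)) i ≡ 0ℤ
  S-φ≡0 i = trans (∙-scale (seidel G i) -1ℤ φ) (cong (λ t → -1ℤ ℤ.* t) (Sφ≡0 i))

edges-upperBound : ∀ k (G : Graph (4 * k + 1)) φ → (∀ i → (seidel G ·ᵥ φ) i ≡ 0ℤ) →
  Signs φ → ∣E G ∣ ≤ 8 * k ^ 2 ∸ k
edges-upperBound k G φ Sφ≡0 sgn = 3k-complement-≤ k (edges-complement-4k+1 k G)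
  (edges-lowerBound k (complement G) φ (complement-null G φ Sφ≡0) sgn)

-- The extremal graphs


infixr 5 _⊍_

-- Adjacency lives on the sum type, so that later block arguments are case distinctions on the value
-- of `splitAt`.
disjointAdj : ∀ {m n} → Graph m → Graph n → Fin m ⊎ Fin n → Fin m ⊎ Fin n → Bool
disjointAdj G H (inj₁ i) (inj₁ j) = adj G i j
disjointAdj G H (inj₂ i) (inj₂ j) = adj H i j
disjointAdj G H _        _        = false

_⊍_ : ∀ {m n} → Graph m → Graph n → Graph (m + n)
_⊍_ {m} G H .adj i j = disjointAdj G H (splitAt m i) (splitAt m j)
_⊍_ {m} G H .symm i j = symmetric (splitAt m i) (splitAt m j)
  where
  symmetric : ∀ s t → disjointAdj G H s t ≡ disjointAdj G H t s
  symmetric (inj₁ i) (inj₁ j) = symm G i j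
  symmetric (inj₁ i) (inj₂ j) = refl
  symmetric (inj₂ i) (inj₁ j) = refl
  symmetric (inj₂ i) (inj₂ j) = symm H i j
_⊍_ {m} G H .irrefl i = irreflexive (splitAt m i)
  where
  irreflexive : ∀ s → disjointAdj G H s s ≡ false
  irreflexive (inj₁ i) = irrefl G i
  irreflexive (inj₂ i) = irrefl H i

module _ {m n} (G : Graph m) (H : Graph n) where

  -- The adjacency matrix is block diagonal: across blocks the products compute to `0ℤ`, leaving a
  -- sum of zeros to discard.
  adjacency-⊍-·ᵥ : ∀ u v i → (adjacency (G ⊍ H) ·ᵥ ([ u , v ]′ ∘ splitAt m)) i ≡
    [ adjacency G ·ᵥ u , adjacency H ·ᵥ v ]′ (splitAt m i)
  adjacency-⊍-·ᵥ u v i = trans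
    (sum-splitAt m (λ t → ⟦ disjointAdj G H (splitAt m i) t ⟧ ℤ.* [ u , v ]′ t))
    (block (splitAt m i))
    where
    block : ∀ s →
      sum (λ j → ⟦ disjointAdj G H s (inj₁ j) ⟧ ℤ.* u j) ℤ.+
      sum (λ j → ⟦ disjointAdj G H s (inj₂ j) ⟧ ℤ.* v j) ≡
      [ adjacency G ·ᵥ u , adjacency H ·ᵥ v ]′ s
    block (inj₁ i) = trans
      (cong (λ t → (adjacency G ·ᵥ u) i ℤ.+ t) (sum-replicate-zero n)) (ℤ.+-identityʳ _)
    block (inj₂ i) = trans
      (cong (λ t → t ℤ.+ (adjacency H ·ᵥ v) i) (sum-replicate-zero m)) (ℤ.+-identityˡ _)

  -- Comparing degree sums avoids splitting edge lists: the degree vector of the union is the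
  -- concatenation of the two degree vectors.
  edges-⊍ : ∣E G ⊍ H ∣ ≡ ∣E G ∣ + ∣E H ∣
  edges-⊍ = ℕ.*-cancelˡ-≡ _ _ 2 (ℤ.+-injective (begin
    + (2 * ∣E G ⊍ H ∣)
      ≡⟨ degreeSum (G ⊍ H) ⟨
    sum (adjacency (G ⊍ H) ·ᵥ 𝟙)
      ≡⟨ sum-cong-≗ (λ i → trans (∙-congʳ (adjacency (G ⊍ H) i) (𝟙-splitAt ∘ splitAt m))
                                 (adjacency-⊍-·ᵥ 𝟙 𝟙 i)) ⟩
    sum ([ adjacency G ·ᵥ 𝟙 , adjacency H ·ᵥ 𝟙 ]′ ∘ splitAt m)
      ≡⟨ sum-splitAt m [ adjacency G ·ᵥ 𝟙 , adjacency H ·ᵥ 𝟙 ]′ ⟩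
    sum (adjacency G ·ᵥ 𝟙) ℤ.+ sum (adjacency H ·ᵥ 𝟙)
      ≡⟨ cong₂ ℤ._+_ (degreeSum G) (degreeSum H) ⟩
    + (2 * ∣E G ∣ + 2 * ∣E H ∣)
      ≡⟨ cong +_ (ℕ.*-distribˡ-+ 2 ∣E G ∣ ∣E H ∣) ⟨
    + (2 * (∣E G ∣ + ∣E H ∣)) ∎))
    where
    𝟙-splitAt : (s : Fin m ⊎ Fin n) → 1ℤ ≡ [ 𝟙 , 𝟙 ]′ s
    𝟙-splitAt (inj₁ _) = refl
    𝟙-splitAt (inj₂ _) = refl

-- The rows condition says S φ = 0 when the entries of φ sum to 1.
record BalancedGraph (n : ℕ) (s : ℤ) (e : ℕ) : Set where
  field
    graph : Graph n
    φ     : Vector ℤ n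
    signs : Signs φ
    rows  : ∀ i → φ i ℤ.+ + 2 ℤ.* (adjacency graph ·ᵥ φ) i ≡ 1ℤ
    total : sum φ ≡ s
    size  : ∣E graph ∣ ≡ e

open BalancedGraph
open IsPhi

-- The `rows` condition has the fixed right-hand side 1 instead of the sum of φ, so it is local to
-- each component and survives unions; totals and sizes add.
balanced-⊍ : ∀ {m n s t e f} → BalancedGraph m s e → BalancedGraph n t f →
  BalancedGraph (m + n) (s ℤ.+ t) (e + f)
balanced-⊍ {m} A B .graph = graph A ⊍ graph B
balanced-⊍ {m} A B .φ     = [ φ A , φ B ]′ ∘ splitAt m
balanced-⊍ {m} A B .signs i with splitAt m i
... | inj₁ j = signs A j
... | inj₂ j = signs B j
balanced-⊍ {m} A B .rows i = trans
  (cong (λ t → [ φ A , φ B ]′ (splitAt m i) ℤ.+ + 2 ℤ.* t)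
        (adjacency-⊍-·ᵥ (graph A) (graph B) (φ A) (φ B) i))
  (block (splitAt m i))
  where
  block : ∀ s → [ φ A , φ B ]′ s ℤ.+
    + 2 ℤ.* [ adjacency (graph A) ·ᵥ φ A , adjacency (graph B) ·ᵥ φ B ]′ s ≡ 1ℤ
  block (inj₁ j) = rows A j
  block (inj₂ j) = rows B j
balanced-⊍ {m} A B .total = trans (sum-splitAt m [ φ A , φ B ]′) (cong₂ ℤ._+_ (total A) (total B))
balanced-⊍ A B .size = trans (edges-⊍ (graph A) (graph B)) (cong₂ _+_ (size A) (size B))

edgeless : ∀ n → Graph n
edgeless n .adj _ _    = false
edgeless n .symm _ _   = refl
edgeless n .irrefl _   = refl

path₄ : Graph 4
path₄ .adj i j = does (toℕ i ℕ.≟ suc (toℕ j)) ∨ does (toℕ j ℕ.≟ suc (toℕ i))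
path₄ .symm i j = Bool.∨-comm (does (toℕ i ℕ.≟ suc (toℕ j))) _
path₄ .irrefl 0F = refl
path₄ .irrefl 1F = refl
path₄ .irrefl 2F = refl
path₄ .irrefl 3F = refl

balanced-∅ : BalancedGraph 0 0ℤ 0
balanced-∅ = record
  { graph = edgeless 0 ; φ = λ () ; signs = λ () ; rows = λ () ; total = refl ; size = refl }

-- The isolated vertex brings the total to 1; the paths contribute 0.
balanced-K₁ : BalancedGraph 1 1ℤ 0
balanced-K₁ = record
  { graph = edgeless 1 ; φ = 𝟙 ; signs = λ _ → inj₁ refl ; rows = λ { 0F → refl }
  ; total = refl ; size = refl }

-- The signs -++- work because an end gives -1 + 2 · 1 = 1 and an inner vertex gives 1 + 2 (-1 + 1)
-- = 1.
balanced-P₄ : BalancedGraph 4 0ℤ 3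
balanced-P₄ .graph = path₄
balanced-P₄ .φ 0F = -1ℤ
balanced-P₄ .φ 1F = 1ℤ
balanced-P₄ .φ 2F = 1ℤ
balanced-P₄ .φ 3F = -1ℤ
balanced-P₄ .signs 0F = inj₂ refl
balanced-P₄ .signs 1F = inj₁ refl
balanced-P₄ .signs 2F = inj₁ refl
balanced-P₄ .signs 3F = inj₂ refl
balanced-P₄ .rows 0F = refl
balanced-P₄ .rows 1F = refl
balanced-P₄ .rows 2F = refl
balanced-P₄ .rows 3F = refl
balanced-P₄ .total = refl
balanced-P₄ .size = refl

-- The products have `k` on the left so that order and size unfold to `4 + k * 4` and `3 + k * 3` in
-- the successor case.
balanced-kP₄ : ∀ k → BalancedGraph (k * 4) 0ℤ (k * 3)
balanced-kP₄ zero    = balanced-∅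
balanced-kP₄ (suc k) = balanced-⊍ balanced-P₄ (balanced-kP₄ k)

-- Attaining the bounds

Attains : ℕ → ℕ → Set
Attains n e = ∃[ G ] (Singular (seidel {n} G) ×
  (∃[ φ ] (IsPhi (seidel G) φ × (∀ i → (φ i ≡ 1ℤ) ⊎ (φ i ≡ -1ℤ)))) ×
  (∣E G ∣ ≡ e))

isPhi⇒singular : ∀ {n} {M : Matrix ℤ n} {φ} → IsPhi M φ → Singular M
isPhi⇒singular {M = M} {φ} φ-isPhi =
  let i , 0<φᵢ , _ = firstPositive φ-isPhi
  in nullVector⇒singular M φ (null φ-isPhi) i (λ φᵢ≡0 → ℤ.<-irrefl (sym φᵢ≡0) 0<φᵢ)

-- Here S φ = (sum φ) 𝟙 - (φ + 2 A φ) = 𝟙 - 𝟙 = 0. A leading entry 1 settles both the gcd and the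
-- sign normalisation.
balanced⇒attains : ∀ {n e} (B : BalancedGraph (suc n) 1ℤ e) → φ B zero ≡ 1ℤ → Attains (suc n) e
balanced⇒attains B φ₀≡1 = graph B , isPhi⇒singular isPhi , (φ B , isPhi , signs B) , size B
  where
  rearrange : ∀ a b c → a ℤ.- b ℤ.- + 2 ℤ.* c ≡ a ℤ.- (b ℤ.+ + 2 ℤ.* c)
  rearrange = solve-∀

  isPhi : IsPhi (seidel (graph B)) (φ B)
  isPhi .null i = begin
    (seidel (graph B) ·ᵥ φ B) i
      ≡⟨ seidel-·ᵥ (graph B) (φ B) i ⟩
    sum (φ B) ℤ.- φ B i ℤ.- + 2 ℤ.* (adjacency (graph B) ·ᵥ φ B) i
      ≡⟨ rearrange (sum (φ B)) (φ B i) ((adjacency (graph B) ·ᵥ φ B) i) ⟩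
    sum (φ B) ℤ.- (φ B i ℤ.+ + 2 ℤ.* (adjacency (graph B) ·ᵥ φ B) i)
      ≡⟨ cong₂ ℤ._-_ (total B) (rows B i) ⟩
    0ℤ ∎
  isPhi .gcd≡1 = trans (cong (λ a → gcd a (Vec.foldr gcd 0ℤ (φ B ∘ suc))) φ₀≡1)
    (cong +_ (ℕ.gcd-zeroˡ ℤ.∣ Vec.foldr gcd 0ℤ (φ B ∘ suc) ∣))
  isPhi .firstPositive = zero , subst (0ℤ ℤ.<_) (sym φ₀≡1) (+<+ (s≤s z≤n)) , λ _ ()

-- Negating S keeps φ. The graph G is returned as well, because the size of its complement is
-- computed from its own.
attains-complement : ∀ {n e} → Attains n e →
  ∃[ G ] (∣E G ∣ ≡ e × Attains n ∣E complement G ∣)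
attains-complement (G , _ , (φ , φ-isPhi , sgn) , ∣E∣≡e) =
  G , ∣E∣≡e , complement G , isPhi⇒singular isPhi , (φ , isPhi , sgn) , refl
  where
  isPhi : IsPhi (seidel (complement G)) φ
  isPhi .null          = complement-null G φ (null φ-isPhi)
  isPhi .gcd≡1         = gcd≡1 φ-isPhi
  isPhi .firstPositive = firstPositive φ-isPhi

attains-3k : ∀ k → Attains (4 * k + 1) (3 * k)
attains-3k k = subst₂ Attains (trans (ℕ.+-comm 1 (k * 4)) (cong (_+ 1) (ℕ.*-comm k 4))) (ℕ.*-comm k 3)
  -- The single vertex comes first, so that vertex zero carries +1; a path would start with -1.
  (balanced⇒attains (balanced-⊍ balanced-K₁ (balanced-kP₄ k)) refl)

attains-8k²∸k : ∀ k → Attains (4 * k + 1) (8 * k ^ 2 ∸ k)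
attains-8k²∸k k =
  let G , ∣E∣≡3k , complement-attains = attains-complement (attains-3k k)
  in subst (Attains (4 * k + 1)) (3k-complement-≡ k (edges-complement-4k+1 k G) ∣E∣≡3k) complement-attains

theorem5p4 : (k : ℕ) →
    ((G : Graph (4 * k + 1)) → Singular (seidel G) →
    (∃[ φ ] (IsPhi (seidel G) φ × (∀ i → (φ i ≡ 1ℤ) ⊎ (φ i ≡ -1ℤ)))) →
    (3 * k ≤ ∣E G ∣) × (∣E G ∣ ≤ 8 * k ^ 2 ∸ k)) ×
    (∃[ G ] (Singular (seidel {4 * k + 1} G) ×
    (∃[ φ ] (IsPhi (seidel G) φ × (∀ i → (φ i ≡ 1ℤ) ⊎ (φ i ≡ -1ℤ)))) ×
    (∣E G ∣ ≡ 3 * k))) ×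
    (∃[ G ] (Singular (seidel {4 * k + 1} G) ×
    (∃[ φ ] (IsPhi (seidel G) φ × (∀ i → (φ i ≡ 1ℤ) ⊎ (φ i ≡ -1ℤ)))) ×
    (∣E G ∣ ≡ 8 * k ^ 2 ∸ k)))
theorem5p4 k =
  (λ G _ (φ , φ-isPhi , sgn) →
    edges-lowerBound k G φ (null φ-isPhi) sgn , edges-upperBound k G φ (null φ-isPhi) sgn) ,
  attains-3k k ,
  attains-8k²∸k k
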